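{- Let $1\le i<j<k$ be integers and let $\sigma=\sigma_1\sigma_2\cdots\sigma_k$ be a permutation of $\{1,\dots,k\}$. Let $\tau=\tau_1\tau_2\cdots\tau_k$ where $\tau_{i+1},\dots,\tau_j$ is a permutation of $\sigma_{i+1},\dots,\sigma_j$ and $\tau_x=\sigma_x$ for $x\in[1,i]\cup[j+1,k]$. Suppose that for every integer $z$ with $\min(i,k-j)<z<k$ all of the following hold: $$\sigma_1\cdots\sigma_z\not\sim\sigma_{k-z+1}\cdots\sigma_k,\qquad \sigma_1\cdots\sigma_z\not\sim\tau_{k-z+1}\cdots\tau_k,$$ $$\tau_1\cdots\tau_z\not\sim\sigma_{k-z+1}\cdots\sigma_k,\qquad \tau_1\cdots\tau_z\not\sim\tau_{k-z+1}\cdots\tau_k.$$ Then the consecutive patterns $\sigma$ and $\tau$ are filling-shape-Wilf-equivalent: $\sigma\equiv_{\mathrm{fs}}\tau$.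
   Context: Two sequences of positive integers of the same length are order-isomorphic, $a_1\cdots a_k\sim b_1\cdots b_k$, if for all $p,q$ one has $a_p<a_q$ iff $b_p<b_q$. A vincular pattern of length $k$ is a pair $(\sigma,T)$ with $\sigma$ a permutation of $\{1,\dots,k\}$ and $T\subseteq\{1,\dots,k-1\}$. A consecutive pattern $\sigma_1\cdots\sigma_k$ (written without dashes) is the case $T=\{1,\dots,k-1\}$. Young diagrams are drawn in French notation: a Young diagram $D$ with $n$ columns and $m$ rows is a set of cells (column, row) in $\{1,\dots,n\}\times\{1,\dots,m\}$ such that if $(a,b)\in D$ then $(a',b')\in D$ for all $1\le a'\le a$, $1\le b'\le b$; the cell $(1,1)$ is at the bottom left. A filling of $D$ is a set of selected cells of $D$ with no two in the same column and no two in the same row. For a column $c$ containing a selected cell, let $\pi(c)$ be the row of that cell. A filling contains the vincular pattern $(\sigma,T)$ of length $k$ if there are columns $i_1<\cdots<i_k$ such that: $(i_1,\pi(i_1)),\dots,(i_k,\pi(i_k))$ are selected cells; $\pi(i_1)\cdots\pi(i_k)\sim\sigma_1\cdots\sigma_k$; $(i_p,\pi(i_q))\in D$ for all $1\le p,q\le k$; and $i_{p+1}-i_p=1$ for all $p\in T$. Otherwise it avoids the pattern. Two vincular patterns $\sigma,\tau$ are filling-shape-Wilf-equivalent, $\sigma\equiv_{\mathrm{fs}}\tau$, if for every Young diagram $D$, every set $R$ of rows and every set $C$ of columns, the number of fillings of $D$ avoiding $\sigma$ whose set of rows without a selected cell is exactly $R$ and whose set of columns without a selected cell is exactly $C$ equals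 the number of such fillings avoiding $\tau$. -}

module Defs where

open import Data.Nat.Base using (ℕ; suc; _+_; _∸_; _≤_; _<_)
open import Data.Nat.Properties
  using (≤-trans; ≤-reflexive; m∸n+n≡m; m+[n∸m]≡n)
open import Data.Fin.Base as Fin using (Fin; toℕ; inject≤; _↑ʳ_)
open import Data.Fin.Permutation using (Permutation′; _⟨$⟩ʳ_)
open import Data.Fin.Subset using (Subset; ⊤; _∈_)
open import Data.List.Base using (length)
import Data.List.Membership.Propositional as List
open import Data.List.Relation.Unary.Unique.Propositional using (Unique)
open import Data.Product.Base using (∃-syntax; _×_; _,_)
open import Data.Vec.Base using (Vec; lookup)
open import Data.Vec.Functional using (Vector)
open import Function.Base using (_∘_)
open import Function.Bundles using (_⇔_)
open import Relation.Binary.PropositionalEquality.Core using (_≡_)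
open import Relation.Nullary.Negation.Core using (¬_)

-- Columns, rows, positions and letters are elements of Fin, so everything that
-- is numbered 1, 2, … in the mathematics is numbered 0, 1, … here.

infix 4 _∼_ _∈ᶜ_ _∉ᶜ_ _≡fs_

_∼_ : ∀ {k} → Vector ℕ k → Vector ℕ k → Set
a ∼ b = ∀ p q → (a p < a q) ⇔ (b p < b q)

word : ∀ {k} → Permutation′ k → Vector ℕ k
word σ p = toℕ (σ ⟨$⟩ʳ p)

-- The z letters of w that come after the first s ones: w_{s+1} ⋯ w_{s+z}.
factor : ∀ {A : Set} {k} s z → s + z ≤ k → Vector A k → Vector A z
factor s z s+z≤k w p = w (inject≤ (s ↑ʳ p) s+z≤k)

-- w_1 ⋯ w_z
prefix : ∀ {A : Set} {k} z → z ≤ k → Vector A k → Vector A z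
prefix z z≤k = factor 0 z z≤k

-- w_{k-z+1} ⋯ w_k
suffix : ∀ {A : Set} {k} z → z ≤ k → Vector A k → Vector A z
suffix {k = k} z z≤k = factor (k ∸ z) z (≤-reflexive (m∸n+n≡m z≤k))

-- w_{i+1} ⋯ w_j
middle : ∀ {A : Set} {k} i j → i ≤ j → j ≤ k → Vector A k → Vector A (j ∸ i)
middle i j i≤j j≤k =
  factor i (j ∸ i) (≤-trans (≤-reflexive (m+[n∸m]≡n i≤j)) j≤k)

-- An element t of T says that the positions numbered t and t + 1 (from 0) must
-- correspond to adjacent columns.
record VincularPattern (k : ℕ) : Set where
  constructor _,ᵛ_
  field
    perm : Permutation′ k
    T    : Subset (k ∸ 1)

consecutive : ∀ {k} → Permutation′ k → VincularPattern k
consecutive σ = σ ,ᵛ ⊤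

-- Sets of cells of the n × m rectangle, stored column by column.
CellSet : ℕ → ℕ → Set
CellSet n m = Vec (Subset m) n

_∈ᶜ_ : ∀ {n m} → Fin n × Fin m → CellSet n m → Set
(a , b) ∈ᶜ S = b ∈ lookup S a

_∉ᶜ_ : ∀ {n m} → Fin n × Fin m → CellSet n m → Set
c ∉ᶜ S = ¬ (c ∈ᶜ S)

record YoungDiagram (n m : ℕ) : Set where
  field
    cells  : CellSet n m
    closed : ∀ {a b a′ b′} → (a , b) ∈ᶜ cells →
             a′ Fin.≤ a → b′ Fin.≤ b → (a′ , b′) ∈ᶜ cells

open YoungDiagram public using (cells)

record IsFilling {n m} (D : YoungDiagram n m) (F : CellSet n m) : Set where
  field
    selected-in-D  : ∀ {a b} → (a , b) ∈ᶜ F → (a , b) ∈ᶜ cells D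
    one-per-column : ∀ {a b b′} → (a , b) ∈ᶜ F → (a , b′) ∈ᶜ F → b ≡ b′
    one-per-row    : ∀ {a a′ b} → (a , b) ∈ᶜ F → (a′ , b) ∈ᶜ F → a ≡ a′

-- As a filling has at most one selected cell per column, row p is forced to be
-- π(col p).
record Occurrence {n m k} (D : YoungDiagram n m) (F : CellSet n m)
                  (P : VincularPattern k) : Set where
  open VincularPattern P
  field
    col        : Fin k → Fin n
    row        : Fin k → Fin m
    increasing : ∀ {p q} → p Fin.< q → col p Fin.< col q
    selected   : ∀ p → (col p , row p) ∈ᶜ F
    pattern-∼  : (toℕ ∘ row) ∼ word perm
    box-in-D   : ∀ p q → (col p , row q) ∈ᶜ cells D
    adjacent   : ∀ {t} → t ∈ T → ∀ {p q} → toℕ p ≡ toℕ t → toℕ q ≡ suc (toℕ t) →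
                 toℕ (col q) ≡ suc (toℕ (col p))

Avoids : ∀ {n m k} → YoungDiagram n m → CellSet n m → VincularPattern k → Set
Avoids D F P = ¬ Occurrence D F P

EmptyRows : ∀ {n m} → CellSet n m → Subset m → Set
EmptyRows F R = ∀ b → (b ∈ R) ⇔ (∀ a → (a , b) ∉ᶜ F)

EmptyColumns : ∀ {n m} → CellSet n m → Subset n → Set
EmptyColumns F C = ∀ a → (a ∈ C) ⇔ (∀ b → (a , b) ∉ᶜ F)

record AvoidingFilling {n m k} (D : YoungDiagram n m) (R : Subset m) (C : Subset n)
                       (P : VincularPattern k) (F : CellSet n m) : Set where
  field
    isFilling    : IsFilling D F
    avoids       : Avoids D F P
    emptyRows    : EmptyRows F R
    emptyColumns : EmptyColumns F C

-- Exactly N elements of A satisfy P. They are listed as elements of A alone, so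
-- different proofs of P x do not count separately.
HasCount : ∀ {A : Set} → (A → Set) → ℕ → Set
HasCount {A} P N =
  ∃[ xs ] Unique xs × (∀ (x : A) → (x List.∈ xs) ⇔ P x) × length xs ≡ N

-- Filling-shape-Wilf-equivalence.
_≡fs_ : ∀ {k l} → VincularPattern k → VincularPattern l → Set
P ≡fs Q = ∀ {n m} (D : YoungDiagram n m) (R : Subset m) (C : Subset n) →
  ∃[ N ] HasCount (AvoidingFilling D R C P) N × HasCount (AvoidingFilling D R C Q) N

{-# OPTIONS --safe #-}
module Submission where

-- Two occurrences of σ or τ in one filling share at most min(i, k − j) columns,
-- so the middle columns (positions i + 1, …, j) of an occurrence lie in no other
-- occurrence. Hence all occurrences of τ can be turned into occurrences of σ at
-- once by permuting their middle columns. No occurrence is created elsewhere,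
-- because one that meets a changed column has to be the changed window itself.
-- Fillings avoiding σ thereby become fillings avoiding τ, and the opposite
-- replacement undoes this.

open import Defs
open import Data.Nat.Base using (ℕ; _≤_; _<_; _∸_; _⊓_)
open import Data.Nat.Properties using (<⇒≤)
open import Data.Fin.Base using (Fin; toℕ)
open import Data.Fin.Permutation using (Permutation′; _⟨$⟩ʳ_)
open import Data.Product.Base using (_×_)
open import Data.Sum.Base using (_⊎_)
open import Data.Vec.Functional.Relation.Binary.Permutation using (_↭_)
open import Relation.Binary.PropositionalEquality.Core using (_≡_)
open import Relation.Nullary.Negation.Core using (¬_)

open import Data.Bool.Base using (Bool; true; false)
open import Data.Nat.Base using (suc; zero; _+_; z≤n; s≤s)
open import Data.Nat.Properties
  using (≤-trans; ≤-<-trans; ≮⇒≥; _<?_; _≤?_; <-cmp; +-assoc; +-suc;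
         +-identityʳ; +-cancelˡ-≡; +-comm; +-monoʳ-<; m≤m+n; m+[n∸m]≡n; m∸[m∸n]≡n; m<n⇒0<n∸m;
         ∸-monoʳ-<; m+n≤o⇒m≤o∸n; m⊓n≤m; m⊓n≤n)
  renaming (_≟_ to _≟ℕ_)
open import Data.Fin.Base as Fin using (inject≤; _↑ʳ_; fromℕ<)
open import Data.Fin.Permutation using (_⟨$⟩ˡ_; inverseˡ; inverseʳ)
open import Data.Fin.Properties
  using (all?; any?; toℕ-injective; toℕ<n; toℕ-fromℕ<; fromℕ<-toℕ; toℕ-inject≤; toℕ-↑ʳ)
  renaming (_≟_ to _≟F_)
open import Data.Fin.Subset using (Subset; _∈_)
open import Data.Fin.Subset.Properties using (_∈?_; ⊆-antisym; ∈⊤)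
open import Data.List.Base as List using (List; []; _∷_; [_]; filter; cartesianProductWith; length)
import Data.List.Membership.Propositional as List
open import Data.List.Membership.Propositional.Properties
  using (∈-filter⁺; ∈-filter⁻; ∈-map⁺; ∈-map⁻; ∈-cartesianProductWith⁺)
open import Data.List.Properties using (length-map; map-∘; map-id-local)
import Data.List.Relation.Unary.All as All
open import Data.List.Relation.Unary.All.Properties using (all-filter)
open import Data.List.Relation.Unary.AllPairs using ([]; _∷_)
open import Data.List.Relation.Unary.Any using (here; there)
open import Data.List.Relation.Unary.Unique.Propositional using (Unique)
import Data.List.Relation.Unary.Unique.Propositional.Properties as Unique
open import Data.Product.Base using (∃-syntax; _,_; proj₁; proj₂)
open import Data.Sum.Base using (inj₁; inj₂; reduce)
open import Data.Vec.Base using (Vec; []; _∷_; lookup; tabulate)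
open import Data.Vec.Properties
  using (∷-injective; lookup∘tabulate; tabulate∘lookup; tabulate-cong)
open import Function.Base using (_∘_; id)
open import Function.Bundles using (_⇔_; mk⇔; Equivalence)
open import Function.Construct.Composition using (_⇔-∘_)
open import Function.Construct.Symmetry using (⇔-sym)
open import Relation.Binary.Definitions using (tri<; tri≈; tri>)
open import Relation.Binary.PropositionalEquality
  using (refl; sym; trans; cong; cong₂; subst; subst₂; module ≡-Reasoning)
open import Relation.Nullary.Decidable.Core
  using (Dec; yes; no; map′; ¬?; _×-dec_; _→-dec_)
open import Relation.Nullary.Negation.Core using (contradiction)
open import Relation.Unary using (Decidable)

open Equivalence using (to; from)

-- Finite enumeration and counting.

_⇔-dec_ : {A B : Set} → Dec A → Dec B → Dec (A ⇔ B)
a? ⇔-dec b? = map′ (λ (f , g) → mk⇔ f g) (λ e → to e , from e) ((a? →-dec b?) ×-dec (b? →-dec a?))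

module _ {A : Set} where

  vectors : List A → ∀ n → List (Vec A n)
  vectors xs zero    = [ [] ]
  vectors xs (suc n) = cartesianProductWith _∷_ xs (vectors xs n)

  vectors-complete : ∀ {xs} → (∀ x → x List.∈ xs) → ∀ {n} (v : Vec A n) → v List.∈ vectors xs n
  vectors-complete complete []      = here refl
  vectors-complete complete (x ∷ v) =
    ∈-cartesianProductWith⁺ _∷_ (complete x) (vectors-complete complete v)

  vectors-unique : ∀ {xs} → Unique xs → ∀ n → Unique (vectors xs n)
  vectors-unique xs! zero    = All.[] ∷ []
  vectors-unique xs! (suc n) =
    Unique.cartesianProductWith⁺ _∷_ ∷-injective xs! (vectors-unique xs! n)

bools : List Bool
bools = true ∷ false ∷ []

bools-complete : ∀ b → b List.∈ bools
bools-complete true  = here refl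
bools-complete false = there (here refl)

bools-unique : Unique bools
bools-unique = ((λ ()) All.∷ All.[]) ∷ (All.[] ∷ [])

module _ {A : Set} {xs : List A} (xs! : Unique xs) (complete : ∀ x → x List.∈ xs)
         {P Q : A → Set} (P? : Decidable P) (f g : A → A)
         (f-maps : ∀ {x} → P x → Q (f x)) (g-maps : ∀ {x} → Q x → P (g x))
         (gf : ∀ {x} → P x → g (f x) ≡ x) (fg : ∀ {x} → Q x → f (g x) ≡ x) where

  -- Only `P` is decided, by filtering the complete list `xs`; `Q` is counted as the image of the
  -- result under `f`.
  equinumerous : ∃[ N ] HasCount P N × HasCount Q N
  equinumerous = length ps ,
    (ps , ps! , (λ x → mk⇔ (proj₂ ∘ ∈-filter⁻ P? {xs = xs}) (∈-filter⁺ P? (complete x))) , refl) ,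
    -- `f` is known to be injective only on `P`. The image list has no repetitions because `g` sends
    -- it back to `ps`.
    (List.map f ps , Unique.map⁻ (subst Unique (sym map-gf) ps!) ,
     (λ x → mk⇔ image⊆ (image⊇ x)) , length-map f ps)
    where
    ps : List A
    ps = filter P? xs

    ps! : Unique ps
    ps! = Unique.filter⁺ P? xs!

    map-gf : List.map g (List.map f ps) ≡ ps
    map-gf = trans (sym (map-∘ ps)) (map-id-local (All.map gf (all-filter P? xs)))

    image⊆ : ∀ {y} → y List.∈ List.map f ps → Q y
    image⊆ y∈ with _ , x∈ , refl ← ∈-map⁻ f y∈ = f-maps (proj₂ (∈-filter⁻ P? {xs = xs} x∈))

    image⊇ : ∀ y → Q y → y List.∈ List.map f ps
    image⊇ y q = subst (List._∈ List.map f ps) (fg q)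
                   (∈-map⁺ f (∈-filter⁺ P? (complete (g y)) (g-maps q)))

-- Cells addressed by column number, and decidability for fillings.

module _ {n m : ℕ} where

  -- Columns as natural numbers, so that the columns of a window are s + toℕ p.
  record At (S : CellSet n m) (x : ℕ) (b : Fin m) : Set where
    constructor cell
    field
      {col}    : Fin n
      col-eq   : toℕ col ≡ x
      selected : (col , b) ∈ᶜ S

  at⁺ : ∀ S {a b} → (a , b) ∈ᶜ S → At S (toℕ a) b
  at⁺ S = cell refl

  at⁻ : ∀ {S a b} → At S (toℕ a) b → (a , b) ∈ᶜ S
  at⁻ {S} {b = b} (cell eq ab∈S) = subst (λ a → (a , b) ∈ᶜ S) (toℕ-injective eq) ab∈S

  at? : ∀ S x b → Dec (At S x b)
  at? S x b = map′ (λ (_ , a≡ , ab∈) → cell a≡ ab∈) (λ (cell a≡ ab∈) → _ , a≡ , ab∈)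
    (any? λ a → (toℕ a ≟ℕ x) ×-dec (b ∈? lookup S a))

  ∈ᶜ-ext : ∀ {S T : CellSet n m} → (∀ a b → ((a , b) ∈ᶜ S) ⇔ ((a , b) ∈ᶜ T)) → S ≡ T
  ∈ᶜ-ext {S} {T} S⇔T = begin
    S                   ≡⟨ tabulate∘lookup S ⟨
    tabulate (lookup S) ≡⟨ tabulate-cong (λ a → ⊆-antisym (to (S⇔T a _)) (from (S⇔T a _))) ⟩
    tabulate (lookup T) ≡⟨ tabulate∘lookup T ⟩
    T                   ∎
    where open ≡-Reasoning

  isFilling? : ∀ (D : YoungDiagram n m) F → Dec (IsFilling D F)
  isFilling? D F = map′
    (λ (sel , col , row) → record
      { selected-in-D  = λ {a} {b} → sel a b
      ; one-per-column = λ {a} {b} {b′} → col a b b′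
      ; one-per-row    = λ {a} {a′} {b} → row a a′ b })
    (λ fil → let open IsFilling fil in
      (λ _ _ → selected-in-D) , (λ _ _ _ → one-per-column) , (λ _ _ _ → one-per-row))
    ((all? λ a → all? λ b → (b ∈? lookup F a) →-dec (b ∈? lookup (cells D) a)) ×-dec
     (all? λ a → all? λ b → all? λ b′ →
        (b ∈? lookup F a) →-dec ((b′ ∈? lookup F a) →-dec (b ≟F b′))) ×-dec
     (all? λ a → all? λ a′ → all? λ b →
        (b ∈? lookup F a) →-dec ((b ∈? lookup F a′) →-dec (a ≟F a′))))

  emptyRows? : ∀ (F : CellSet n m) R → Dec (EmptyRows F R)
  emptyRows? F R = all? λ b → (b ∈? R) ⇔-dec (all? λ a → ¬? (b ∈? lookup F a))

  emptyColumns? : ∀ (F : CellSet n m) C → Dec (EmptyColumns F C)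
  emptyColumns? F C = all? λ a → (a ∈? C) ⇔-dec (all? λ b → ¬? (b ∈? lookup F a))

-- Occurrences of consecutive patterns as windows of columns.

module Windows {n m k : ℕ} (D : YoungDiagram n m) where

  -- An occurrence of the consecutive pattern ρ in the columns s, …, s + k − 1,
  -- without a choice of rows, so that it is decidable by finite search.
  record Occ (F : CellSet n m) (ρ : Permutation′ k) (s : ℕ) : Set where
    field
      full  : ∀ (p : Fin k) → ∃[ b ] At F (s + toℕ p) b
      order : ∀ (p q : Fin k) b c → At F (s + toℕ p) b → At F (s + toℕ q) c →
              (toℕ b < toℕ c) ⇔ (word ρ p < word ρ q)
      box   : ∀ (p q : Fin k) b → At F (s + toℕ q) b → At (cells D) (s + toℕ p) b

  open Occ public

  occ? : ∀ F ρ s → Dec (Occ F ρ s)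
  occ? F ρ s = map′
    (λ (f , o , b) → record { full = f ; order = o ; box = b })
    (λ occ → full occ , order occ , box occ)
    ((all? λ p → any? λ b → at? F _ b) ×-dec
     (all? λ p → all? λ q → all? λ b → all? λ c → at? F _ b →-dec (at? F _ c →-dec
       ((toℕ b <? toℕ c) ⇔-dec (word ρ p <? word ρ q)))) ×-dec
     (all? λ p → all? λ q → all? λ b → at? F _ b →-dec at? (cells D) _ b))

  -- In the shared columns both words are order-isomorphic to the rows of the same selected cells.
  overlap-∼ : ∀ {F ρ ρ′ s s′ z} → Occ F ρ s → Occ F ρ′ s′ → (f g : Fin z → Fin k) →
              (∀ p → s + toℕ (f p) ≡ s′ + toℕ (g p)) → (word ρ ∘ f) ∼ (word ρ′ ∘ g)
  overlap-∼ {F} occ occ′ f g same-column p q =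
    let b , b∈ = full occ (f p)
        c , c∈ = full occ (f q)
    in order occ′ (g p) (g q) b c (shift p b∈) (shift q c∈) ⇔-∘
       ⇔-sym (order occ (f p) (f q) b c b∈ c∈)
    where
    shift : ∀ p {b} → At F _ b → At F _ b
    shift p {b} = subst (λ x → At F x b) (same-column p)

  occ-transfer : ∀ {F G ρ s} → (∀ p b → At G (s + toℕ p) b ⇔ At F (s + toℕ p) b) →
                 Occ G ρ s → Occ F ρ s
  occ-transfer G⇔F occ = record
    { full  = λ p → let b , b∈ = full occ p in b , to (G⇔F p b) b∈
    ; order = λ p q b c b∈ c∈ → order occ p q b c (from (G⇔F p b) b∈) (from (G⇔F q c) c∈)
    ; box   = λ p q b b∈ → box occ p q b (from (G⇔F q b) b∈)
    }

  occ-∼ : ∀ {F ρ ρ′ s} → word ρ ∼ word ρ′ → Occ F ρ s → Occ F ρ′ s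
  occ-∼ ρ∼ρ′ occ = record
    { full  = full occ
    ; order = λ p q b c b∈ c∈ → ρ∼ρ′ p q ⇔-∘ order occ p q b c b∈ c∈
    ; box   = box occ
    }

  occ⇒occurrence : ∀ {F ρ s} → Occ F ρ s → Occurrence D F (consecutive ρ)
  occ⇒occurrence {F} {ρ} {s} occ = record
    { col        = col
    ; row        = row
    ; increasing = λ p<q → subst₂ _<_ (sym (col-eq _)) (sym (col-eq _)) (+-monoʳ-< s p<q)
    ; selected   = λ p → At.selected (at-row p)
    ; pattern-∼  = λ p q → order occ p q _ _ (at-row p) (at-row q)
    ; box-in-D   = λ p q → at⁻ (subst (λ x → At (cells D) x _) (sym (col-eq p))
                                      (box occ p q _ (at-row q)))
    ; adjacent   = λ {t} _ {p} {q} p≡t q≡1+t → begin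
        toℕ (col q)         ≡⟨ col-eq q ⟩
        s + toℕ q           ≡⟨ cong (s +_) q≡1+t ⟩
        s + suc (toℕ t)     ≡⟨ +-suc s (toℕ t) ⟩
        suc (s + toℕ t)     ≡⟨ cong (λ x → suc (s + x)) p≡t ⟨
        suc (s + toℕ p)     ≡⟨ cong suc (col-eq p) ⟨
        suc (toℕ (col p))   ∎
    }
    where
    open ≡-Reasoning
    row : Fin k → Fin m
    row p = proj₁ (full occ p)
    at-row : ∀ p → At F (s + toℕ p) (row p)
    at-row p = proj₂ (full occ p)
    col : Fin k → Fin n
    col p = At.col (at-row p)
    col-eq : ∀ p → toℕ (col p) ≡ s + toℕ p
    col-eq p = At.col-eq (at-row p)

  -- `Occ` constrains every selected cell of the window, an `Occurrence` only its chosen rows; a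
  -- filling has one selected cell per column, so these are the same cells.
  occurrence⇒occ : 0 < k → ∀ {F ρ} → IsFilling D F → Occurrence D F (consecutive ρ) →
                   ∃[ s ] Occ F ρ s
  occurrence⇒occ 0<k {F} {ρ} fil o = s , record
    { full  = λ p → row p , cell (col-eq p) (selected p)
    ; order = λ p q b c b∈ c∈ →
        subst₂ (λ b c → (toℕ b < toℕ c) ⇔ (word ρ p < word ρ q))
               (row-unique p b∈) (row-unique q c∈) (pattern-∼ p q)
    ; box   = λ p q b b∈ →
        cell (col-eq p) (subst (λ b → (col p , b) ∈ᶜ cells D) (row-unique q b∈) (box-in-D p q))
    }
    where
    open Occurrence o
    s : ℕ
    s = toℕ (col (fromℕ< 0<k))

    col-fromℕ< : ∀ x (x<k : x < k) → toℕ (col (fromℕ< x<k)) ≡ s + x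
    col-fromℕ< zero    0<k    = sym (+-identityʳ s)
    -- `T` is full, so its element numbered `x` is available; it links the positions `x` and
    -- `x + 1`.
    col-fromℕ< (suc x) 1+x<k@(s≤s x<k-1) = begin
      toℕ (col (fromℕ< 1+x<k))     ≡⟨ adjacent (∈⊤ {x = fromℕ< x<k-1})
                                       (trans (toℕ-fromℕ< x<k) (sym (toℕ-fromℕ< x<k-1)))
                                       (trans (toℕ-fromℕ< 1+x<k) (cong suc (sym (toℕ-fromℕ< x<k-1)))) ⟩
      suc (toℕ (col (fromℕ< x<k))) ≡⟨ cong suc (col-fromℕ< x x<k) ⟩
      suc (s + x)                  ≡⟨ +-suc s x ⟨
      s + suc x                    ∎
      where
      open ≡-Reasoning
      x<k : x < k
      x<k = <⇒≤ 1+x<k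

    col-eq : ∀ p → toℕ (col p) ≡ s + toℕ p
    col-eq p = subst (λ q → toℕ (col q) ≡ s + toℕ p) (fromℕ<-toℕ p (toℕ<n p))
                     (col-fromℕ< (toℕ p) (toℕ<n p))

    row-unique : ∀ p {b} → At F (s + toℕ p) b → row p ≡ b
    row-unique p {b} b∈ = IsFilling.one-per-column fil (selected p)
      (at⁻ (subst (λ x → At F x b) (sym (col-eq p)) b∈))

-- The patterns σ and τ are indexed by Bool, so that the four non-overlap
-- hypotheses become one and their symmetry is manifest.
module Replacement {n m k : ℕ} (D : YoungDiagram n m) {i j : ℕ} (j≤k : j ≤ k)
  (ρ : Bool → Permutation′ k)
  (agree : ∀ x y p → toℕ p < i ⊎ j ≤ toℕ p → ρ x ⟨$⟩ʳ p ≡ ρ y ⟨$⟩ʳ p)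
  (separated : ∀ x y z → i ⊓ (k ∸ j) < z → (z<k : z < k) →
    ¬ (prefix z (<⇒≤ z<k) (word (ρ x)) ∼ suffix z (<⇒≤ z<k) (word (ρ y)))) where

  open Windows {k = k} D

  -- Middle positions and overlaps of occurrences.

  Mid : Fin k → Set
  Mid p = i ≤ toℕ p × toℕ p < j

  mid? : Decidable Mid
  mid? p = (i ≤? toℕ p) ×-dec (toℕ p <? j)

  -- `ρ x` has at `θ x y p` the letter that `ρ y` has at `p`. Hence copying column `θ x y p` of a
  -- `ρ x` window into column `p`, for all `p`, yields a `ρ y` window.
  θ : Bool → Bool → Fin k → Fin k
  θ x y p = ρ x ⟨$⟩ˡ (ρ y ⟨$⟩ʳ p)

  θ-inverse : ∀ x y p → θ x y (θ y x p) ≡ p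
  θ-inverse x y p = trans (cong (ρ x ⟨$⟩ˡ_) (inverseʳ (ρ y))) (inverseˡ (ρ x))

  θ-injective : ∀ x y {p q} → θ x y p ≡ θ x y q → p ≡ q
  θ-injective x y {p} {q} eq = begin
    p               ≡⟨ θ-inverse y x p ⟨
    θ y x (θ x y p) ≡⟨ cong (θ y x) eq ⟩
    θ y x (θ x y q) ≡⟨ θ-inverse y x q ⟩
    q               ∎
    where open ≡-Reasoning

  θ-fixed : ∀ x y {p} → ¬ Mid p → θ x y p ≡ p
  θ-fixed x y {p} ¬mid = trans (cong (ρ x ⟨$⟩ˡ_) (agree y x p outside)) (inverseˡ (ρ x))
    where
    outside : toℕ p < i ⊎ j ≤ toℕ p
    outside with toℕ p <? i
    ... | yes p<i = inj₁ p<i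
    ... | no  p≮i = inj₂ (≮⇒≥ λ p<j → ¬mid (≮⇒≥ p≮i , p<j))

  -- An image outside the middle would be fixed by `θ x y`, hence equal to `p` by injectivity, but
  -- `p` is in the middle.
  θ-mid : ∀ x y {p} → Mid p → Mid (θ x y p)
  θ-mid x y {p} mid with mid? (θ x y p)
  ... | yes mid′ = mid′
  ... | no ¬mid′ = contradiction (subst Mid (sym (θ-injective x y (θ-fixed x y ¬mid′))) mid) ¬mid′

  -- The windows share `k ∸ d` columns, which carry a suffix of the earlier word and a prefix of the
  -- later one; `separated` forbids that these are order-isomorphic.
  no-overlap : ∀ {F x y s d} → 0 < d → d ≤ k → i ⊓ (k ∸ j) < k ∸ d →
               Occ F (ρ x) s → ¬ Occ F (ρ y) (s + d)
  no-overlap {x = x} {y} {s} {d} 0<d d≤k large occ occ′ =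
    separated y x z large z<k
      -- The position maps are spelled as in `factor`, so the result is definitionally the excluded
      -- relation.
      (overlap-∼ occ′ occ (λ p → inject≤ (0 ↑ʳ p) z≤k) (λ p → inject≤ ((k ∸ z) ↑ʳ p) _) λ p → begin
        s + d + toℕ (inject≤ p z≤k)                  ≡⟨ +-assoc s d _ ⟩
        s + (d + toℕ (inject≤ p z≤k))                ≡⟨ cong (λ t → s + (d + t)) (toℕ-inject≤ p _) ⟩
        s + (d + toℕ p)                              ≡⟨ cong (λ t → s + (t + toℕ p)) (m∸[m∸n]≡n d≤k) ⟨
        s + (k ∸ z + toℕ p)                          ≡⟨ cong (s +_) (toℕ-↑ʳ (k ∸ z) p) ⟨
        s + toℕ ((k ∸ z) ↑ʳ p)                       ≡⟨ cong (s +_) (toℕ-inject≤ ((k ∸ z) ↑ʳ p) _) ⟨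
        s + toℕ (inject≤ ((k ∸ z) ↑ʳ p) _)           ∎)
    where
    open ≡-Reasoning
    z : ℕ
    z = k ∸ d
    z<k : z < k
    z<k = ∸-monoʳ-< 0<d d≤k
    z≤k : z ≤ k
    z≤k = <⇒≤ z<k

  -- A column in the middle of one occurrence lies far enough from both ends that any other window
  -- through it would overlap in more than `i ⊓ (k ∸ j)` columns. The position `p′` is arbitrary, so
  -- edge columns of the second window are covered too.
  same-start : ∀ {F x y s s′} → Occ F (ρ x) s → Occ F (ρ y) s′ → ∀ {p p′} → Mid p →
               s + toℕ p ≡ s′ + toℕ p′ → s ≡ s′
  same-start {F} {x} {y} {s} {s′} occ occ′ {p} {p′} (i≤p , p<j) eq with <-cmp s s′
  ... | tri≈ _ s≡s′ _ = s≡s′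
  -- The shift satisfies `d ≤ toℕ p < j`, so the overlap `k ∸ d` exceeds `k ∸ j`.
  ... | tri< s<s′ _ _ = contradiction
      (subst (Occ F (ρ y)) (sym (m+[n∸m]≡n (<⇒≤ s<s′))) occ′)
      (no-overlap (m<n⇒0<n∸m s<s′) (≤-trans (<⇒≤ d<j) j≤k)
        (≤-<-trans (m⊓n≤n i (k ∸ j)) (∸-monoʳ-< d<j j≤k)) occ)
    where
    d : ℕ
    d = s′ ∸ s
    p≡d+p′ : toℕ p ≡ d + toℕ p′
    p≡d+p′ = +-cancelˡ-≡ s _ _ (trans eq
      (trans (cong (_+ toℕ p′) (sym (m+[n∸m]≡n (<⇒≤ s<s′)))) (+-assoc s d _)))
    d<j : d < j
    d<j = ≤-<-trans (m≤m+n d _) (subst (_< j) p≡d+p′ p<j)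
  -- Now `d + toℕ p = toℕ p′ < k`, so the overlap `k ∸ d` exceeds `toℕ p`, which is at least `i`.
  ... | tri> _ _ s′<s = contradiction
      (subst (Occ F (ρ x)) (sym (m+[n∸m]≡n (<⇒≤ s′<s))) occ)
      (no-overlap (m<n⇒0<n∸m s′<s) (≤-trans (m≤m+n d _) (<⇒≤ d+p<k))
        (≤-<-trans (m⊓n≤m i (k ∸ j)) (≤-<-trans i≤p
          (m+n≤o⇒m≤o∸n (suc (toℕ p)) (subst (_≤ k) (cong suc (+-comm d (toℕ p))) d+p<k)))) occ′)
    where
    d : ℕ
    d = s ∸ s′
    p′≡d+p : toℕ p′ ≡ d + toℕ p
    p′≡d+p = +-cancelˡ-≡ s′ _ _ (trans (sym eq)
      (trans (cong (_+ toℕ p) (sym (m+[n∸m]≡n (<⇒≤ s′<s)))) (+-assoc s′ d _)))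
    d+p<k : d + toℕ p < k
    d+p<k = subst (_< k) p′≡d+p (toℕ<n p′)

  same-position : ∀ {s s′} {p p′ : Fin k} → s ≡ s′ → s + toℕ p ≡ s′ + toℕ p′ → p ≡ p′
  same-position {s} refl eq = toℕ-injective (+-cancelˡ-≡ s _ _ eq)

  -- The replacement map.

  record Covered (F : CellSet n m) (x : Bool) (c : ℕ) : Set where
    constructor covered
    field
      {start} : ℕ
      {pos}   : Fin k
      mid     : Mid pos
      occ     : Occ F (ρ x) start
      column  : c ≡ start + toℕ pos

  abstract
    -- Abstract, so that the search is never unfolded; later proofs only distinguish its two
    -- outcomes.
    covered? : ∀ F x c → Dec (Covered F x c)
    covered? F x c = map′
      (λ (_ , _ , mid , occ , eq) → covered mid occ eq)
      bounded
      (any? λ s → any? λ p → mid? p ×-dec (occ? F (ρ x) (toℕ s) ×-dec (c ≟ℕ toℕ s + toℕ p)))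
      where
      -- An occurrence has a cell in column `s + toℕ p` of the board, so `s < n` and searching
      -- starts in `Fin n` suffices.
      bounded : Covered F x c →
                ∃[ s ] ∃[ p ] Mid p × Occ F (ρ x) (toℕ {n} s) × c ≡ toℕ s + toℕ p
      bounded (covered {s} {p} mid occ eq) =
        fromℕ< s<n , p , mid , subst (Occ F (ρ x)) (sym s≡) occ ,
        trans eq (cong (_+ toℕ p) (sym s≡))
        where
        s<n : s < n
        s<n = let _ , cell {a} a≡ _ = full occ p in
          ≤-<-trans (m≤m+n s _) (subst (_< n) a≡ (toℕ<n a))
        s≡ : toℕ (fromℕ< s<n) ≡ s
        s≡ = toℕ-fromℕ< s<n

  -- The column of `F` whose content the new column `a` receives; `full` provides it as an element
  -- of `Fin n`. The decision is an argument so that proofs can split on it.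
  source : ∀ {F} x y (a : Fin n) → Dec (Covered F x (toℕ a)) → Fin n
  source x y a (yes (covered {pos = p} _ occ _)) = At.col (proj₂ (full occ (θ x y p)))
  source x y a (no _)                            = a

  -- Replaces every occurrence of ρ x by an occurrence of ρ y in the same
  -- columns and rows.
  replace : Bool → Bool → CellSet n m → CellSet n m
  replace x y F = tabulate λ a → lookup F (source x y a (covered? F x (toℕ a)))

  module _ {F : CellSet n m} {x y : Bool} where

    private
      F′ : CellSet n m
      F′ = replace x y F

      src : Fin n → Fin n
      src a = source x y a (covered? F x (toℕ a))

    ∈-replace : ∀ a b → ((a , b) ∈ᶜ F′) ⇔ ((src a , b) ∈ᶜ F)
    ∈-replace a b = mk⇔ (subst (b ∈_) eq) (subst (b ∈_) (sym eq))
      where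
      eq : lookup F′ a ≡ lookup F (src a)
      eq = lookup∘tabulate _ a

    -- The search may return a witness other than the given one; `same-start` and `same-position`
    -- identify the two.
    source-covered : ∀ {a s p} → Occ F (ρ x) s → Mid p → toℕ a ≡ s + toℕ p →
                     toℕ (src a) ≡ s + toℕ (θ x y p)
    source-covered {a} {s} {p} occ mid a≡ with covered? F x (toℕ a)
    ... | no ¬cov = contradiction (covered mid occ a≡) ¬cov
    ... | yes (covered {s′} {p′} mid′ occ′ a≡′) =
      trans (At.col-eq (proj₂ (full occ′ (θ x y p′))))
            (cong₂ (λ s p → s + toℕ (θ x y p)) s′≡s (same-position s′≡s eq))
      where
      eq : s′ + toℕ p′ ≡ s + toℕ p
      eq = trans (sym a≡′) a≡
      s′≡s : s′ ≡ s
      s′≡s = same-start occ′ occ mid′ eq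

    source-uncovered : ∀ {a} → ¬ Covered F x (toℕ a) → src a ≡ a
    source-uncovered {a} ¬cov with covered? F x (toℕ a)
    ... | yes cov = contradiction cov ¬cov
    ... | no _    = refl

    -- An edge column of an occurrence is not moved: `θ x y` fixes its position, and it is in the
    -- middle of no occurrence of `ρ x`, since by `same-start` that would be this very window.
    source-window : ∀ {a s} p → Occ F (ρ x) s → toℕ a ≡ s + toℕ p →
                    toℕ (src a) ≡ s + toℕ (θ x y p)
    source-window {a} {s} p occ a≡ with mid? p
    ... | yes mid = source-covered occ mid a≡
    ... | no ¬mid = begin
      toℕ (src a)         ≡⟨ cong toℕ (source-uncovered not-covered) ⟩
      toℕ a               ≡⟨ a≡ ⟩
      s + toℕ p           ≡⟨ cong (λ q → s + toℕ q) (θ-fixed x y ¬mid) ⟨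
      s + toℕ (θ x y p)   ∎
      where
      open ≡-Reasoning
      not-covered : ¬ Covered F x (toℕ a)
      not-covered (covered mid′ occ′ a≡′) =
        let eq = trans (sym a≡′) a≡
        in ¬mid (subst Mid (same-position (same-start occ′ occ mid′ eq) eq) mid′)

    at-replace-window : ∀ {s} p b → Occ F (ρ x) s →
                        At F′ (s + toℕ p) b ⇔ At F (s + toℕ (θ x y p)) b
    at-replace-window {s} p b occ = mk⇔
      (λ (cell {a} a≡ ab∈) → cell (source-window p occ a≡) (to (∈-replace a b) ab∈))
      (λ at → let _ , cell {a} a≡ _ = full occ p in cell a≡ (from (∈-replace a b)
          (at⁻ (subst (λ c → At F c b) (sym (source-window p occ a≡)) at))))

    at-replace-uncovered : ∀ {c} b → ¬ Covered F x c → At F′ c b ⇔ At F c b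
    at-replace-uncovered {c} b ¬cov = mk⇔
      (λ (cell {a} a≡ ab∈) →
        cell a≡ (subst (λ e → (e , b) ∈ᶜ F) (same a≡) (to (∈-replace a b) ab∈)))
      (λ (cell {a} a≡ ab∈) →
        cell a≡ (from (∈-replace a b) (subst (λ e → (e , b) ∈ᶜ F) (sym (same a≡)) ab∈)))
      where
      same : ∀ {a} → toℕ a ≡ c → src a ≡ a
      same refl = source-uncovered ¬cov

    -- Position `p` now shows the row from position `θ x y p`, whose letter in `ρ x` is that of
    -- `ρ y` at `p`. The rows of the window stay the same as a set, so `box` persists.
    replace-occ : ∀ {s} → Occ F (ρ x) s → Occ F′ (ρ y) s
    replace-occ {s} occ = record
      { full  = λ p → let b , at = full occ (θ x y p) in b , from (at-replace-window p b occ) at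
      ; order = λ p q b c b∈ c∈ →
          subst₂ (λ t u → (toℕ b < toℕ c) ⇔ (toℕ t < toℕ u)) (inverseʳ (ρ x)) (inverseʳ (ρ x))
            (order occ (θ x y p) (θ x y q) b c
              (to (at-replace-window p b occ) b∈) (to (at-replace-window q c occ) c∈))
      ; box   = λ p q b b∈ → box occ p (θ x y q) b (to (at-replace-window q b occ) b∈)
      }

    -- If the window meets a covered column, that column is in the middle of a replaced window,
    -- which holds `ρ y` in `F′`; `same-start` inside `F′` identifies the windows. Otherwise all its
    -- columns are unchanged.
    occ-replace : ∀ {w s} → Occ F′ (ρ w) s → Occ F (ρ x) s ⊎ Occ F (ρ w) s
    occ-replace {w} {s} occ′ with any? (λ p → covered? F x (s + toℕ p))
    ... | yes (p , covered mid occ eq) =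
      inj₁ (subst (Occ F (ρ x)) (same-start (replace-occ occ) occ′ mid (sym eq)) occ)
    ... | no ¬any =
      inj₂ (occ-transfer (λ p b → at-replace-uncovered b (λ cov → ¬any (p , cov))) occ′)

    source-injective : ∀ {a a′} → src a ≡ src a′ → a ≡ a′
    source-injective {a} {a′} eq = go (covered? F x (toℕ a)) (covered? F x (toℕ a′))
      where
      -- Were `a′` uncovered, it would be its own source, hence the source of `a`, which is again a
      -- middle column by `θ-mid`.
      mixed : ∀ {a a′} → src a ≡ src a′ → Covered F x (toℕ a) → Covered F x (toℕ a′)
      mixed {a} {a′} eq (covered mid occ a≡) with covered? F x (toℕ a′)
      ... | yes cov = cov
      ... | no ¬cov = covered (θ-mid x y mid) occ
        (trans (cong toℕ (sym eq)) (source-covered occ mid a≡))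
      go : Dec (Covered F x (toℕ a)) → Dec (Covered F x (toℕ a′)) → a ≡ a′
      go (yes cov) (no ¬cov) = contradiction (mixed eq cov) ¬cov
      go (no ¬cov) (yes cov) = contradiction (mixed (sym eq) cov) ¬cov
      go (no ¬cov) (no ¬cov′) =
        trans (sym (source-uncovered ¬cov)) (trans eq (source-uncovered ¬cov′))
      go (yes (covered {s} {p} mid occ a≡)) (yes (covered {s′} {p′} mid′ occ′ a≡′)) =
        toℕ-injective (begin
          toℕ a         ≡⟨ a≡ ⟩
          s + toℕ p     ≡⟨ cong₂ (λ s p → s + toℕ p) s≡s′
                            (θ-injective x y (same-position s≡s′ columns)) ⟩
          s′ + toℕ p′   ≡⟨ a≡′ ⟨
          toℕ a′        ∎)
        where
        open ≡-Reasoning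
        columns : s + toℕ (θ x y p) ≡ s′ + toℕ (θ x y p′)
        columns = trans (sym (source-covered occ mid a≡))
                        (trans (cong toℕ eq) (source-covered occ′ mid′ a≡′))
        s≡s′ : s ≡ s′
        s≡s′ = same-start occ occ′ (θ-mid x y mid) columns

    -- Fillings, avoidance and empty lines under replacement.

    replace-filling : IsFilling D F → IsFilling D F′
    replace-filling fil = record
      { selected-in-D  = λ {a} {b} → in-D a b (covered? F x (toℕ a))
      ; one-per-column = λ {a} ab∈ ab′∈ →
          one-per-column (to (∈-replace a _) ab∈) (to (∈-replace a _) ab′∈)
      ; one-per-row    = λ {a} {a′} ab∈ a′b∈ →
          source-injective (one-per-row (to (∈-replace a _) ab∈) (to (∈-replace a′ _) a′b∈))
      }
      where
      open IsFilling fil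
      in-D : ∀ a b → Dec (Covered F x (toℕ a)) → (a , b) ∈ᶜ F′ → (a , b) ∈ᶜ cells D
      in-D a b (no ¬cov) ab∈ =
        selected-in-D (at⁻ (to (at-replace-uncovered b ¬cov) (at⁺ F′ ab∈)))
      -- The row comes from position `θ x y p`; `box` places it inside `D` in column `p` as well.
      in-D a b (yes (covered {s} {p} _ occ a≡)) ab∈ =
        at⁻ (subst (λ c → At (cells D) c b) (sym a≡)
          (box occ p (θ x y p) b (to (at-replace-window p b occ) (cell a≡ ab∈))))

    module _ (avoids : ∀ s → ¬ Occ F (ρ y) s) where

      -- Converse of `replace-occ`: the second replacement acts on exactly the windows changed by
      -- the first.
      occ-replaced : ∀ {s} → Occ F′ (ρ y) s → Occ F (ρ x) s
      occ-replaced occ′ with occ-replace {w = y} occ′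
      ... | inj₁ occ = occ
      ... | inj₂ occ = contradiction occ (avoids _)

      -- An occurrence would give the window both patterns in F′, so that ρ x ∼ ρ y
      -- and F already had an occurrence of ρ y there.
      replace-avoids : ∀ s → ¬ Occ F′ (ρ x) s
      replace-avoids s occ′ =
        avoids s (occ-∼ (overlap-∼ occ′ (replace-occ occ) id id (λ _ → refl)) occ)
        where
        occ : Occ F (ρ x) s
        -- With `w = x` both alternatives of `occ-replace` are the same statement.
        occ = reduce (occ-replace {w = x} occ′)

  row-occupied : ∀ x y F {a b} → (a , b) ∈ᶜ replace x y F → ∃[ a′ ] (a′ , b) ∈ᶜ F
  row-occupied x y F {a} {b} ab∈ = _ , to (∈-replace {F} {x} {y} a b) ab∈

  -- A covered column lies in an occurrence, so it was already occupied in `F`, whatever it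
  -- received.
  column-occupied : ∀ x y F {a b} → (a , b) ∈ᶜ replace x y F → ∃[ b′ ] (a , b′) ∈ᶜ F
  column-occupied x y F {a} {b} ab∈ with covered? F x (toℕ a)
  ... | no ¬cov = b , at⁻ (to (at-replace-uncovered b ¬cov) (at⁺ (replace x y F) ab∈))
  ... | yes (covered {pos = p} _ occ a≡) =
    let b′ , at = full occ p in b′ , at⁻ (subst (λ c → At F c b′) (sym a≡) at)

  -- The columns covered by `ρ x` in `F` and by `ρ y` in `F′` are the same, and there `θ x y` undoes
  -- `θ y x`.
  replace-inverse : ∀ {F x y} → (∀ s → ¬ Occ F (ρ y) s) → replace y x (replace x y F) ≡ F
  replace-inverse {F} {x} {y} avoids = ∈ᶜ-ext λ a b →
    mk⇔ at⁻ (at⁺ F) ⇔-∘ (same (toℕ a) b (covered? F′ y (toℕ a)) ⇔-∘ mk⇔ (at⁺ F″) at⁻)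
    where
    F′ : CellSet n m
    F′ = replace x y F
    F″ : CellSet n m
    F″ = replace y x F′
    same : ∀ c b → Dec (Covered F′ y c) → At F″ c b ⇔ At F c b
    same c b (no ¬cov′) =
      at-replace-uncovered b (λ { (covered mid occ eq) → ¬cov′ (covered mid (replace-occ occ) eq) })
      ⇔-∘ at-replace-uncovered b ¬cov′
    same c b (yes (covered {s} {p} mid occ′ refl)) =
      subst (λ q → At F″ (s + toℕ p) b ⇔ At F (s + toℕ q) b) (θ-inverse x y p)
        (at-replace-window (θ y x p) b (occ-replaced avoids occ′) ⇔-∘ at-replace-window p b occ′)

  -- Avoiding fillings with prescribed empty rows and columns.

  module _ (0<k : 0 < k) (R : Subset m) (C : Subset n) where

    Avoiding : Bool → CellSet n m → Set
    Avoiding x = AvoidingFilling D R C (consecutive (ρ x))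

    no-occ : ∀ {x F} → Avoiding x F → ∀ s → ¬ Occ F (ρ x) s
    no-occ av s occ = AvoidingFilling.avoids av (occ⇒occurrence occ)

    avoiding? : ∀ x → Decidable (Avoiding x)
    -- Being a filling is decided first, because only then does every `Occurrence` give a window
    -- that the search can find.
    avoiding? x F with isFilling? D F
    ... | no ¬fil = no (¬fil ∘ AvoidingFilling.isFilling)
    ... | yes fil = map′
      (λ (av , rows , cols) → record
        { isFilling = fil ; avoids = av ; emptyRows = rows ; emptyColumns = cols })
      (λ av → let open AvoidingFilling av in avoids , emptyRows , emptyColumns)
      (avoids? ×-dec (emptyRows? F R ×-dec emptyColumns? F C))
      where
      avoids? : Dec (Avoids D F (consecutive (ρ x)))
      avoids? = ¬? (map′ (occ⇒occurrence ∘ proj₂) bounded (any? λ s → occ? F (ρ x) (toℕ {n} s)))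
        where
        bounded : Occurrence D F (consecutive (ρ x)) → ∃[ s ] Occ F (ρ x) (toℕ {n} s)
        bounded o =
          let s , occ = occurrence⇒occ 0<k fil o
              _ , cell {a} a≡ _ = full occ (fromℕ< 0<k)
              s<n = ≤-<-trans (m≤m+n s _) (subst (_< n) a≡ (toℕ<n a))
          in fromℕ< s<n , subst (Occ F (ρ x)) (sym (toℕ-fromℕ< s<n)) occ

    replace-avoiding : ∀ {x y F} → Avoiding y F → Avoiding x (replace x y F)
    replace-avoiding {x} {y} {F} av = record
      { isFilling    = fil′
      ; avoids       = λ o → let s , occ′ = occurrence⇒occ 0<k fil′ o in
                             replace-avoids (no-occ av) s occ′
      ; emptyRows    = λ b → mk⇔
          (λ empty a ab∈ → let a′ , a′b∈ = row-occupied x y F ab∈ in to (emptyRows b) empty a′ a′b∈)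
          (λ empty → from (emptyRows b) λ a ab∈ →
            let a′ , a′b∈ = row-occupied y x (replace x y F) (back ab∈) in empty a′ a′b∈)
      ; emptyColumns = λ a → mk⇔
          (λ empty b ab∈ → let b′ , ab′∈ = column-occupied x y F ab∈ in to (emptyColumns a) empty b′ ab′∈)
          (λ empty → from (emptyColumns a) λ b ab∈ →
            let b′ , ab′∈ = column-occupied y x (replace x y F) (back ab∈) in empty b′ ab′∈)
      }
      where
      open AvoidingFilling av
      fil′ : IsFilling D (replace x y F)
      fil′ = replace-filling isFilling
      -- Recovering `F` by the opposite replacement gives the reverse implications for empty rows
      -- and columns.
      back : ∀ {a b} → (a , b) ∈ᶜ F → (a , b) ∈ᶜ replace y x (replace x y F)
      back {a} {b} = subst (λ G → (a , b) ∈ᶜ G) (sym (replace-inverse (no-occ av)))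

    equal-counts : ∀ x y → ∃[ N ] HasCount (Avoiding x) N × HasCount (Avoiding y) N
    equal-counts x y = equinumerous
      (vectors-unique (vectors-unique bools-unique m) n)
      (vectors-complete (vectors-complete bools-complete))
      -- A filling that avoids `ρ x` has its occurrences of `ρ y` replaced, hence `replace y x` as
      -- the forward map.
      (avoiding? x) (replace y x) (replace x y) replace-avoiding replace-avoiding
      (λ av → replace-inverse (no-occ av)) (λ av → replace-inverse (no-occ av))

theorem3p5 : (i j k : ℕ) → 1 ≤ i → (i<j : i < j) → (j<k : j < k) →
    (σ τ : Permutation′ k) →
    middle i j (<⇒≤ i<j) (<⇒≤ j<k) (word τ) ↭ middle i j (<⇒≤ i<j) (<⇒≤ j<k) (word σ) →
    (∀ (x : Fin k) → toℕ x < i ⊎ j ≤ toℕ x → τ ⟨$⟩ʳ x ≡ σ ⟨$⟩ʳ x) →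
    (∀ z → i ⊓ (k ∸ j) < z → (z<k : z < k) →
    ¬ (prefix z (<⇒≤ z<k) (word σ) ∼ suffix z (<⇒≤ z<k) (word σ)) ×
    ¬ (prefix z (<⇒≤ z<k) (word σ) ∼ suffix z (<⇒≤ z<k) (word τ)) ×
    ¬ (prefix z (<⇒≤ z<k) (word τ) ∼ suffix z (<⇒≤ z<k) (word σ)) ×
    ¬ (prefix z (<⇒≤ z<k) (word τ) ∼ suffix z (<⇒≤ z<k) (word τ))) →
    consecutive σ ≡fs consecutive τ
theorem3p5 i j k 1≤i i<j j<k σ τ _ τ≡σ distinct D R C =
  Replacement.equal-counts D (<⇒≤ j<k) ρ agree separated (≤-<-trans z≤n j<k) R C false true
  where
  ρ : Bool → Permutation′ k
  ρ false = σ
  ρ true  = τ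
  agree : ∀ x y p → toℕ p < i ⊎ j ≤ toℕ p → ρ x ⟨$⟩ʳ p ≡ ρ y ⟨$⟩ʳ p
  agree false false p _       = refl
  agree false true  p outside = sym (τ≡σ p outside)
  agree true  false p outside = τ≡σ p outside
  agree true  true  p _       = refl
  separated : ∀ x y z → i ⊓ (k ∸ j) < z → (z<k : z < k) →
    ¬ (prefix z (<⇒≤ z<k) (word (ρ x)) ∼ suffix z (<⇒≤ z<k) (word (ρ y)))
  separated false false z l z<k = proj₁ (distinct z l z<k)
  separated false true  z l z<k = proj₁ (proj₂ (distinct z l z<k))
  separated true  false z l z<k = proj₁ (proj₂ (proj₂ (distinct z l z<k)))
  separated true  true  z l z<k = proj₂ (proj₂ (proj₂ (distinct z l z<k)))
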